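{- Let $D$ be a real symmetric matrix of order $n$ with $\mathbf{e}\in R(D)$, and let $\mathbf{w}\in\mathbb{R}^n$ satisfy $\mathbf{e}'\mathbf{w}=1$. Let $L$ be a real Laplacian-like matrix of order $n$ and let $\alpha$ be a non-zero real number. Then $$D^{\dagger}=-\frac12L+\alpha\,\mathbf{w}\mathbf{w}'$$ if and only if $D\mathbf{w}=\frac1\alpha\mathbf{e}$ and $LD+2I=2\mathbf{w}\mathbf{e}'+\widetilde V$ for some real symmetric matrix $\widetilde V$ satisfying $D\widetilde V=O$ and $\widetilde V\left(-\frac12L+\alpha\,\mathbf{w}\mathbf{w}'\right)=O$.
   Context: A prime denotes transpose; $\mathbf{e}\in\mathbb{R}^n$ is the all-ones column vector; $R(D)$ is the range (column space) of $D$; $I$ is the identity and $O$ the zero matrix of order $n$. A real matrix is Laplacian-like if it is symmetric and all its row sums are zero. The Moore-Penrose inverse $M^\dagger$ of a real matrix $M$ is the unique $X$ with $MXM=M$, $XMX=X$, $(MX)'=MX$, $(XM)'=XM$. -}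

module Defs where

open import Algebra.Apartness.Bundles using (HeytingCommutativeRing; HeytingField)
open import Algebra.Bundles using (CommutativeRing)
open import Algebra.Definitions using (Invertible)
open import Algebra.Structures using (IsCommutativeRing)
import Algebra.Properties.CommutativeMonoid.Sum as CommutativeMonoidSum
open import Data.Bool.Base using (if_then_else_)
open import Data.Empty using (⊥; ⊥-elim)
open import Data.Fin.Properties using () renaming (_≟_ to _≟ᶠ_)
open import Data.Integer.Base using (+_)
open import Data.Nat.Base as ℕ using (ℕ; _≤_)
import Data.Nat.Properties as ℕ
open import Data.Product.Base using (∃; _×_; _,_; proj₁; proj₂)
open import Data.Rational.Base as ℚ using (ℚ; 0ℚ; 1ℚ; ½; ∣_∣)
import Data.Rational.Properties as ℚ
open import Data.Rational.Solver using (module +-*-Solver)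
open import Data.Sum.Base using (_⊎_; inj₁; inj₂; [_,_]′)
open import Data.Vec.Functional using (Vector)
import Level
open import Level using (0ℓ)
open import Relation.Binary.Definitions using (Tight; Cotransitive)
open import Relation.Binary.PropositionalEquality
  using (_≡_; _≢_; refl; sym; trans; cong; cong₂; subst)
open import Relation.Nullary using (¬_; yes; no; contradiction)
open import Relation.Nullary.Decidable using (⌊_⌋)

-- `T N i` says that the index `i` lies in the N-th tail of the index set.

record Tails (I : Set) : Set₁ where
  field
    T     : ℕ → I → Set
    split : ∀ {M N i} → T (M ℕ.⊔ N) i → T M i × T N i

  Eventually : (I → Set) → Set
  Eventually P = ∃ λ N → ∀ i → T N i → P i

  Vanishes : (I → ℚ) → Set
  Vanishes f = ∀ ε → 0ℚ ℚ.< ε → Eventually λ i → ∣ f i ∣ ℚ.< ε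

  Bounded : (I → ℚ) → Set
  Bounded f = ∃ λ B → 0ℚ ℚ.< B × Eventually λ i → ∣ f i ∣ ℚ.≤ B

ℕ-tails : Tails ℕ
ℕ-tails = record
  { T     = _≤_
  ; split = λ p → ℕ.m⊔n≤o⇒m≤o _ _ p , ℕ.m⊔n≤o⇒n≤o _ _ p
  }

ℕ²-tails : Tails (ℕ × ℕ)
ℕ²-tails = record
  { T     = λ { N (m , n) → N ≤ m × N ≤ n }
  ; split = λ { (p , q) → (ℕ.m⊔n≤o⇒m≤o _ _ p , ℕ.m⊔n≤o⇒m≤o _ _ q)
                        , (ℕ.m⊔n≤o⇒n≤o _ _ p , ℕ.m⊔n≤o⇒n≤o _ _ q) }
  }

Null : (ℕ → ℚ) → Set
Null = Tails.Vanishes ℕ-tails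

IsCauchy : (ℕ → ℚ) → Set
IsCauchy x = Tails.Vanishes ℕ²-tails λ { (m , n) → x m ℚ.- x n }

-- Total reciprocal, with the junk value 0 at 0.
inv : ℚ → ℚ
inv p with p ℚ.≟ 0ℚ
... | yes _   = 0ℚ
... | no  p≢0 = ℚ.1/_ p {{ℚ.≢-nonZero p≢0}}

module Rational where
  open ℚ.≤-Reasoning
  open +-*-Solver using (solve; _:+_; _:*_; :-_; _:=_)

  half+half : ∀ ε → ε ℚ.* ½ ℚ.+ ε ℚ.* ½ ≡ ε
  half+half ε = trans (sym (ℚ.*-distribˡ-+ ε ½ ½)) (ℚ.*-identityʳ ε)

  *-pos : ∀ {p q} → 0ℚ ℚ.< p → 0ℚ ℚ.< q → 0ℚ ℚ.< p ℚ.* q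
  *-pos {p} {q} 0<p 0<q = ℚ.positive⁻¹ (p ℚ.* q)
    {{ℚ.pos*pos⇒pos p {{ℚ.positive 0<p}} q {{ℚ.positive 0<q}}}}

  0<½ : 0ℚ ℚ.< ½
  0<½ = ℚ.positive⁻¹ ½

  half-pos : ∀ {ε} → 0ℚ ℚ.< ε → 0ℚ ℚ.< ε ℚ.* ½
  half-pos 0<ε = *-pos 0<ε 0<½

  inv-inverse : ∀ {p} → p ≢ 0ℚ → inv p ℚ.* p ≡ 1ℚ
  inv-inverse {p} p≢0 with p ℚ.≟ 0ℚ
  ... | yes p≡0  = contradiction p≡0 p≢0
  ... | no  p≢0′ = ℚ.*-inverseˡ p {{ℚ.≢-nonZero p≢0′}}

  >⇒≢ : ∀ {p} → 0ℚ ℚ.< p → p ≢ 0ℚ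
  >⇒≢ 0<p p≡0 = ℚ.<-irrefl (sym p≡0) 0<p

  ∣∣>⇒≢ : ∀ {c p} → 0ℚ ℚ.< c → c ℚ.< ∣ p ∣ → p ≢ 0ℚ
  ∣∣>⇒≢ 0<c c<∣p∣ refl = ℚ.<-asym 0<c c<∣p∣

  inv-pos : ∀ {p} → 0ℚ ℚ.< p → 0ℚ ℚ.< inv p
  inv-pos {p} 0<p with p ℚ.≟ 0ℚ
  ... | yes p≡0 = contradiction p≡0 (>⇒≢ 0<p)
  ... | no  p≢0 = ℚ.positive⁻¹ _ {{ℚ.1/pos⇒pos p {{ℚ.positive 0<p}}}}

  ∣inv∣≤ : ∀ {c p} → 0ℚ ℚ.< c → c ℚ.< ∣ p ∣ → ∣ inv p ∣ ℚ.≤ inv c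
  ∣inv∣≤ {c} {p} 0<c c<∣p∣ =
    ℚ.*-cancelʳ-≤-pos c {{ℚ.positive 0<c}} (begin
      ∣ inv p ∣ ℚ.* c      ≤⟨ ℚ.*-monoˡ-≤-nonNeg ∣ inv p ∣ {{ℚ.∣-∣-nonNeg (inv p)}} (ℚ.<⇒≤ c<∣p∣) ⟩
      ∣ inv p ∣ ℚ.* ∣ p ∣  ≡⟨ ℚ.∣p*q∣≡∣p∣*∣q∣ (inv p) p ⟨
      ∣ inv p ℚ.* p ∣      ≡⟨ cong ∣_∣ (inv-inverse (∣∣>⇒≢ 0<c c<∣p∣)) ⟩
      1ℚ                   ≡⟨ inv-inverse (>⇒≢ 0<c) ⟨
      inv c ℚ.* c          ∎)

  ∣-∣-comm : ∀ p q → ∣ p ℚ.- q ∣ ≡ ∣ q ℚ.- p ∣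
  ∣-∣-comm p q = trans
    (cong ∣_∣ (solve 2 (λ p q → p :+ :- q := :- (q :+ :- p)) refl p q))
    (ℚ.∣-p∣≡∣p∣ (q ℚ.- p))

  p≡[p-q]+q : ∀ p q → p ≡ (p ℚ.- q) ℚ.+ q
  p≡[p-q]+q = solve 2 (λ p q → p := (p :+ :- q) :+ q) refl

  ∣p∣≤∣p-q∣+∣q∣ : ∀ p q → ∣ p ∣ ℚ.≤ ∣ p ℚ.- q ∣ ℚ.+ ∣ q ∣
  ∣p∣≤∣p-q∣+∣q∣ p q = begin
    ∣ p ∣                  ≡⟨ cong ∣_∣ (p≡[p-q]+q p q) ⟩
    ∣ (p ℚ.- q) ℚ.+ q ∣    ≤⟨ ℚ.∣p+q∣≤∣p∣+∣q∣ (p ℚ.- q) q ⟩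
    ∣ p ℚ.- q ∣ ℚ.+ ∣ q ∣  ∎

  p-0≡p : ∀ p → p ℚ.- 0ℚ ≡ p
  p-0≡p = ℚ.+-identityʳ

  telescope : ∀ p q r → (p ℚ.- q) ℚ.+ (q ℚ.- r) ≡ p ℚ.- r
  telescope = solve 3 (λ p q r → (p :+ :- q) :+ (q :+ :- r) := p :+ :- r) refl

  sum-diff : ∀ p q r s → (p ℚ.- r) ℚ.+ (q ℚ.- s) ≡ (p ℚ.+ q) ℚ.- (r ℚ.+ s)
  sum-diff = solve 4 (λ p q r s →
    (p :+ :- r) :+ (q :+ :- s) := (p :+ q) :+ :- (r :+ s)) refl

  product-diff : ∀ p q r s →
    p ℚ.* (q ℚ.- s) ℚ.+ s ℚ.* (p ℚ.- r) ≡ p ℚ.* q ℚ.- r ℚ.* s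
  product-diff = solve 4 (λ p q r s →
    p :* (q :+ :- s) :+ s :* (p :+ :- r) := p :* q :+ :- (r :* s)) refl

  neg-diff : ∀ p q → ℚ.- (p ℚ.- q) ≡ ℚ.- p ℚ.- ℚ.- q
  neg-diff = solve 2 (λ p q → :- (p :+ :- q) := :- p :+ :- (:- q)) refl

  inv-diff : ∀ {p q} → p ≢ 0ℚ → q ≢ 0ℚ →
    (inv p ℚ.* inv q) ℚ.* (q ℚ.- p) ≡ inv p ℚ.- inv q
  inv-diff {p} {q} p≢0 q≢0 = begin-equality
    (inv p ℚ.* inv q) ℚ.* (q ℚ.- p)
      ≡⟨ solve 4 (λ p q a b → (a :* b) :* (q :+ :- p) := a :* (b :* q) :+ :- (b :* (a :* p)))
           refl p q (inv p) (inv q) ⟩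
    inv p ℚ.* (inv q ℚ.* q) ℚ.- inv q ℚ.* (inv p ℚ.* p)
      ≡⟨ cong₂ (λ a b → inv p ℚ.* a ℚ.- inv q ℚ.* b) (inv-inverse q≢0) (inv-inverse p≢0) ⟩
    inv p ℚ.* 1ℚ ℚ.- inv q ℚ.* 1ℚ
      ≡⟨ cong₂ ℚ._-_ (ℚ.*-identityʳ (inv p)) (ℚ.*-identityʳ (inv q)) ⟩
    inv p ℚ.- inv q ∎

module TailsProperties {I : Set} (tails : Tails I) where
  open Tails tails
  open Rational
  open ℚ.≤-Reasoning

  both : ∀ {P Q : I → Set} → Eventually P → Eventually Q → Eventually λ i → P i × Q i
  both (M , p) (N , q) = M ℕ.⊔ N , λ i t → p i (proj₁ (split t)) , q i (proj₂ (split t))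

  map : ∀ {P Q : I → Set} → (∀ i → P i → Q i) → Eventually P → Eventually Q
  map f (N , p) = N , λ i t → f i (p i t)

  vanishes-eventually : ∀ {f g} → Eventually (λ i → f i ≡ g i) → Vanishes f → Vanishes g
  vanishes-eventually f≡g f→0 ε 0<ε =
    map (λ { i (eq , lt) → subst (λ p → ∣ p ∣ ℚ.< ε) eq lt }) (both f≡g (f→0 ε 0<ε))

  vanishes-cong : ∀ {f g} → (∀ i → f i ≡ g i) → Vanishes f → Vanishes g
  vanishes-cong f≡g = vanishes-eventually (0 , λ i _ → f≡g i)

  vanishes-0 : ∀ {f} → (∀ i → f i ≡ 0ℚ) → Vanishes f
  vanishes-0 f≡0 ε 0<ε = 0 , λ i _ → subst (λ p → ∣ p ∣ ℚ.< ε) (sym (f≡0 i)) 0<ε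

  vanishes-neg : ∀ {f} → Vanishes f → Vanishes λ i → ℚ.- f i
  vanishes-neg {f} f→0 ε 0<ε =
    map (λ i → subst (ℚ._< ε) (sym (ℚ.∣-p∣≡∣p∣ (f i)))) (f→0 ε 0<ε)

  vanishes-+ : ∀ {f g} → Vanishes f → Vanishes g → Vanishes λ i → f i ℚ.+ g i
  vanishes-+ {f} {g} f→0 g→0 ε 0<ε =
    map (λ { i (p , q) → begin-strict
              ∣ f i ℚ.+ g i ∣         ≤⟨ ℚ.∣p+q∣≤∣p∣+∣q∣ (f i) (g i) ⟩
              ∣ f i ∣ ℚ.+ ∣ g i ∣     <⟨ ℚ.+-mono-< p q ⟩
              ε ℚ.* ½ ℚ.+ ε ℚ.* ½     ≡⟨ half+half ε ⟩
              ε                       ∎ })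
        (both (f→0 (ε ℚ.* ½) (half-pos 0<ε)) (g→0 (ε ℚ.* ½) (half-pos 0<ε)))

  vanishes-* : ∀ {f g} → Bounded f → Vanishes g → Vanishes λ i → f i ℚ.* g i
  vanishes-* {f} {g} (B , 0<B , f≤B) g→0 ε 0<ε =
    map (λ { i (p , q) → begin-strict
              ∣ f i ℚ.* g i ∣        ≡⟨ ℚ.∣p*q∣≡∣p∣*∣q∣ (f i) (g i) ⟩
              ∣ f i ∣ ℚ.* ∣ g i ∣    ≤⟨ ℚ.*-monoʳ-≤-nonNeg ∣ g i ∣ {{ℚ.∣-∣-nonNeg (g i)}} p ⟩
              B ℚ.* ∣ g i ∣          <⟨ ℚ.*-monoʳ-<-pos B {{ℚ.positive 0<B}} q ⟩
              B ℚ.* (inv B ℚ.* ε)    ≡⟨ ℚ.*-assoc B (inv B) ε ⟨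
              (B ℚ.* inv B) ℚ.* ε    ≡⟨ cong (ℚ._* ε) (trans (ℚ.*-comm B (inv B)) (inv-inverse (>⇒≢ 0<B))) ⟩
              1ℚ ℚ.* ε               ≡⟨ ℚ.*-identityˡ ε ⟩
              ε                      ∎ })
        (both f≤B (g→0 (inv B ℚ.* ε) (*-pos (inv-pos 0<B) 0<ε)))

  bounded-* : ∀ {f g} → Bounded f → Bounded g → Bounded λ i → f i ℚ.* g i
  bounded-* {f} {g} (B , 0<B , f≤B) (C , 0<C , g≤C) =
    B ℚ.* C , *-pos 0<B 0<C ,
    map (λ { i (p , q) → begin
              ∣ f i ℚ.* g i ∣        ≡⟨ ℚ.∣p*q∣≡∣p∣*∣q∣ (f i) (g i) ⟩
              ∣ f i ∣ ℚ.* ∣ g i ∣    ≤⟨ ℚ.*-monoʳ-≤-nonNeg ∣ g i ∣ {{ℚ.∣-∣-nonNeg (g i)}} p ⟩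
              B ℚ.* ∣ g i ∣          ≤⟨ ℚ.*-monoˡ-≤-nonNeg B {{ℚ.pos⇒nonNeg B {{ℚ.positive 0<B}}}} q ⟩
              B ℚ.* C                ∎ })
        (both f≤B g≤C)

private
  module N where
    open TailsProperties ℕ-tails public

    inhabited : ∀ {P : ℕ → Set} → Tails.Eventually ℕ-tails P → ∃ P
    inhabited (N , p) = N , p N ℕ.≤-refl

  module N² = TailsProperties ℕ²-tails

open Tails ℕ-tails public using (Eventually)

-- The real numbers: Cauchy sequences of rationals, with equality
-- modulo null sequences.
record ℝ : Set where
  constructor mkℝ
  field
    seq    : ℕ → ℚ
    cauchy : IsCauchy seq

open ℝ public

infix  8 -ℝ_
infixl 7 _*ℝ_
infixl 6 _+ℝ_ _-ℝ_
infix  4 _≈ℝ_ _#_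

_≈ℝ_ : ℝ → ℝ → Set
x ≈ℝ y = Null λ n → seq x n ℚ.- seq y n

-- Positive version of x ≉ y: eventually, the terms keep some positive
-- distance.  Classically, x # y is equivalent to ¬ (x ≈ℝ y).
_#_ : ℝ → ℝ → Set
x # y = ∃ λ ε → 0ℚ ℚ.< ε × Eventually λ n → ε ℚ.< ∣ seq x n ℚ.- seq y n ∣

private
  fst-bounded : ∀ {f} → Tails.Bounded ℕ-tails f →
                Tails.Bounded ℕ²-tails λ { (m , n) → f m }
  fst-bounded (B , 0<B , N , f≤B) = B , 0<B , N , λ { (m , n) (p , _) → f≤B m p }

  snd-bounded : ∀ {f} → Tails.Bounded ℕ-tails f →
                Tails.Bounded ℕ²-tails λ { (m , n) → f n }
  snd-bounded (B , 0<B , N , f≤B) = B , 0<B , N , λ { (m , n) (_ , q) → f≤B n q }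

0<1 : 0ℚ ℚ.< 1ℚ
0<1 = ℚ.positive⁻¹ 1ℚ

bounded : ∀ x → Tails.Bounded ℕ-tails (seq x)
bounded x with cauchy x 1ℚ 0<1
... | N , osc = 1ℚ ℚ.+ ∣ seq x N ∣
    , ℚ.<-≤-trans 0<1 (begin
        1ℚ                     ≡⟨ ℚ.+-identityʳ 1ℚ ⟨
        1ℚ ℚ.+ 0ℚ              ≤⟨ ℚ.+-monoʳ-≤ 1ℚ (ℚ.0≤∣p∣ (seq x N)) ⟩
        1ℚ ℚ.+ ∣ seq x N ∣     ∎)
    , N , λ n N≤n → begin
        ∣ seq x n ∣                                ≤⟨ Rational.∣p∣≤∣p-q∣+∣q∣ (seq x n) (seq x N) ⟩
        ∣ seq x n ℚ.- seq x N ∣ ℚ.+ ∣ seq x N ∣    ≤⟨ ℚ.+-monoˡ-≤ ∣ seq x N ∣ (ℚ.<⇒≤ (osc (n , N) (N≤n , ℕ.≤-refl))) ⟩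
        1ℚ ℚ.+ ∣ seq x N ∣                         ∎
  where open ℚ.≤-Reasoning

-- The Cauchy proofs are abstract, so that normalising a real number does
-- not unfold them.
private abstract
  const-cauchy : ∀ q → IsCauchy λ _ → q
  const-cauchy q = N².vanishes-0 λ _ → ℚ.+-inverseʳ q

  +-cauchy : ∀ x y → IsCauchy λ n → seq x n ℚ.+ seq y n
  +-cauchy x y = N².vanishes-cong
    (λ { (m , n) → Rational.sum-diff (seq x m) (seq y m) (seq x n) (seq y n) })
    (N².vanishes-+ (cauchy x) (cauchy y))

  neg-cauchy : ∀ x → IsCauchy λ n → ℚ.- seq x n
  neg-cauchy x = N².vanishes-cong
    (λ { (m , n) → Rational.neg-diff (seq x m) (seq x n) })
    (N².vanishes-neg (cauchy x))

  *-cauchy : ∀ x y → IsCauchy λ n → seq x n ℚ.* seq y n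
  *-cauchy x y = N².vanishes-cong
    (λ { (m , n) → Rational.product-diff (seq x m) (seq y m) (seq x n) (seq y n) })
    (N².vanishes-+ (N².vanishes-* (fst-bounded (bounded x)) (cauchy y))
                   (N².vanishes-* (snd-bounded (bounded y)) (cauchy x)))

fromℚ : ℚ → ℝ
fromℚ q = mkℝ (λ _ → q) (const-cauchy q)

0ℝ 1ℝ 2ℝ ½ℝ : ℝ
0ℝ = fromℚ 0ℚ
1ℝ = fromℚ 1ℚ
2ℝ = fromℚ (+ 2 ℚ./ 1)
½ℝ = fromℚ ½

_+ℝ_ : ℝ → ℝ → ℝ
x +ℝ y = mkℝ (λ n → seq x n ℚ.+ seq y n) (+-cauchy x y)

-ℝ_ : ℝ → ℝ
-ℝ x = mkℝ (λ n → ℚ.- seq x n) (neg-cauchy x)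

_-ℝ_ : ℝ → ℝ → ℝ
x -ℝ y = x +ℝ -ℝ y

_*ℝ_ : ℝ → ℝ → ℝ
x *ℝ y = mkℝ (λ n → seq x n ℚ.* seq y n) (*-cauchy x y)

private
  apart-from-0 : ∀ {x} → x # 0ℝ → ∃ λ c → 0ℚ ℚ.< c × Eventually λ n → c ℚ.< ∣ seq x n ∣
  apart-from-0 {x} (c , 0<c , c<) =
    c , 0<c , N.map (λ n → subst (λ p → c ℚ.< ∣ p ∣) (Rational.p-0≡p (seq x n))) c<

  inv-bounded : ∀ {x} → x # 0ℝ → Tails.Bounded ℕ-tails λ n → inv (seq x n)
  inv-bounded {x} x#0 with apart-from-0 {x} x#0
  ... | c , 0<c , c< = inv c , Rational.inv-pos 0<c , N.map (λ n → Rational.∣inv∣≤ 0<c) c<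

  nonzero : ∀ {x} → x # 0ℝ → Eventually λ n → seq x n ≢ 0ℚ
  nonzero {x} x#0 with apart-from-0 {x} x#0
  ... | c , 0<c , c< = N.map (λ n → Rational.∣∣>⇒≢ 0<c) c<

private abstract
  recip-cauchy : ∀ x → x # 0ℝ → IsCauchy λ n → inv (seq x n)
  recip-cauchy x x#0 = N².vanishes-eventually diff
    (N².vanishes-* (N².bounded-* (fst-bounded (inv-bounded {x} x#0)) (snd-bounded (inv-bounded {x} x#0)))
      (N².vanishes-cong (λ { (m , n) → flip (seq x m) (seq x n) })
        (N².vanishes-neg (cauchy x))))
    where
    open +-*-Solver
    flip : ∀ p q → ℚ.- (p ℚ.- q) ≡ q ℚ.- p
    flip = solve 2 (λ p q → :- (p :+ :- q) := q :+ :- p) refl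

    diff : Tails.Eventually ℕ²-tails λ { (m , n) →
      (inv (seq x m) ℚ.* inv (seq x n)) ℚ.* (seq x n ℚ.- seq x m)
        ≡ inv (seq x m) ℚ.- inv (seq x n) }
    diff = let N , ≢0 = nonzero {x} x#0
           in N , λ { (m , n) (p , q) → Rational.inv-diff (≢0 m p) (≢0 n q) }

-- The reciprocal 1/x; the apartness proof only serves to show that the
-- sequence of reciprocals is Cauchy.
recip : (x : ℝ) → x # 0ℝ → ℝ
recip x x#0 = mkℝ (λ n → inv (seq x n)) (recip-cauchy x x#0)

recip-inverseˡ : ∀ x (x#0 : x # 0ℝ) → recip x x#0 *ℝ x ≈ℝ 1ℝ
recip-inverseˡ x x#0 = N.vanishes-eventually
  (N.map (λ n ≢0 → sym (trans (cong (ℚ._- 1ℚ) (Rational.inv-inverse ≢0)) (ℚ.+-inverseʳ 1ℚ)))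
    (nonzero {x} x#0))
  (N.vanishes-0 λ _ → refl)

pointwise : ∀ {x y} → (∀ n → seq x n ≡ seq y n) → x ≈ℝ y
pointwise {x} {y} eq = N.vanishes-0 λ n →
  trans (cong (ℚ._- seq y n) (eq n)) (ℚ.+-inverseʳ (seq y n))

≈ℝ-refl : ∀ {x} → x ≈ℝ x
≈ℝ-refl {x} = pointwise {x} {x} λ _ → refl

≈ℝ-sym : ∀ {x y} → x ≈ℝ y → y ≈ℝ x
≈ℝ-sym {x} {y} x≈y ε 0<ε = N.map
  (λ n → subst (ℚ._< ε) (Rational.∣-∣-comm (seq x n) (seq y n))) (x≈y ε 0<ε)

≈ℝ-trans : ∀ {x y z} → x ≈ℝ y → y ≈ℝ z → x ≈ℝ z
≈ℝ-trans {x} {y} {z} x≈y y≈z = N.vanishes-cong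
  (λ n → Rational.telescope (seq x n) (seq y n) (seq z n)) (N.vanishes-+ x≈y y≈z)

+ℝ-cong : ∀ {x y u v} → x ≈ℝ y → u ≈ℝ v → (x +ℝ u) ≈ℝ (y +ℝ v)
+ℝ-cong {x} {y} {u} {v} x≈y u≈v = N.vanishes-cong
  (λ n → Rational.sum-diff (seq x n) (seq u n) (seq y n) (seq v n)) (N.vanishes-+ x≈y u≈v)

-ℝ-cong : ∀ {x y} → x ≈ℝ y → (-ℝ x) ≈ℝ (-ℝ y)
-ℝ-cong {x} {y} x≈y = N.vanishes-cong
  (λ n → Rational.neg-diff (seq x n) (seq y n)) (N.vanishes-neg x≈y)

*ℝ-cong : ∀ {x y u v} → x ≈ℝ y → u ≈ℝ v → (x *ℝ u) ≈ℝ (y *ℝ v)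
*ℝ-cong {x} {y} {u} {v} x≈y u≈v = N.vanishes-cong
  (λ n → Rational.product-diff (seq x n) (seq u n) (seq y n) (seq v n))
  (N.vanishes-+ (N.vanishes-* (bounded x) u≈v) (N.vanishes-* (bounded v) x≈y))

*ℝ-comm : ∀ x y → x *ℝ y ≈ℝ y *ℝ x
*ℝ-comm x y = pointwise {x *ℝ y} {y *ℝ x} λ n → ℚ.*-comm (seq x n) (seq y n)

ℝ-isCommutativeRing : IsCommutativeRing _≈ℝ_ _+ℝ_ _*ℝ_ -ℝ_ 0ℝ 1ℝ
ℝ-isCommutativeRing = record
  { isRing = record
    { +-isAbelianGroup = record
      { isGroup = record
        { isMonoid = record
          { isSemigroup = record
            { isMagma = record
              { isEquivalence = record
                { refl  = λ {x} → ≈ℝ-refl {x}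
                ; sym   = λ {x} {y} → ≈ℝ-sym {x} {y}
                ; trans = λ {x} {y} {z} → ≈ℝ-trans {x} {y} {z}
                }
              ; ∙-cong = λ {x} {y} {u} {v} → +ℝ-cong {x} {y} {u} {v}
              }
            ; assoc = λ x y z → pointwise {(x +ℝ y) +ℝ z} {x +ℝ (y +ℝ z)}
                λ n → ℚ.+-assoc (seq x n) (seq y n) (seq z n)
            }
          ; identity = (λ x → pointwise {0ℝ +ℝ x} {x} λ n → ℚ.+-identityˡ (seq x n))
                     , (λ x → pointwise {x +ℝ 0ℝ} {x} λ n → ℚ.+-identityʳ (seq x n))
          }
        ; inverse = (λ x → pointwise { -ℝ x +ℝ x} {0ℝ} λ n → ℚ.+-inverseˡ (seq x n))
                  , (λ x → pointwise {x +ℝ -ℝ x} {0ℝ} λ n → ℚ.+-inverseʳ (seq x n))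
        ; ⁻¹-cong = λ {x} {y} → -ℝ-cong {x} {y}
        }
      ; comm = λ x y → pointwise {x +ℝ y} {y +ℝ x} λ n → ℚ.+-comm (seq x n) (seq y n)
      }
    ; *-cong = λ {x} {y} {u} {v} → *ℝ-cong {x} {y} {u} {v}
    ; *-assoc = λ x y z → pointwise {(x *ℝ y) *ℝ z} {x *ℝ (y *ℝ z)}
        λ n → ℚ.*-assoc (seq x n) (seq y n) (seq z n)
    ; *-identity = (λ x → pointwise {1ℝ *ℝ x} {x} λ n → ℚ.*-identityˡ (seq x n))
                 , (λ x → pointwise {x *ℝ 1ℝ} {x} λ n → ℚ.*-identityʳ (seq x n))
    ; distrib = (λ x y z → pointwise {x *ℝ (y +ℝ z)} {x *ℝ y +ℝ x *ℝ z}
                   λ n → ℚ.*-distribˡ-+ (seq x n) (seq y n) (seq z n))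
              , (λ x y z → pointwise {(y +ℝ z) *ℝ x} {y *ℝ x +ℝ z *ℝ x}
                   λ n → ℚ.*-distribʳ-+ (seq x n) (seq y n) (seq z n))
    }
  ; *-comm = *ℝ-comm
  }

#-irrefl : ∀ {x y} → x ≈ℝ y → ¬ x # y
#-irrefl x≈y (ε , 0<ε , >ε) =
  let n , lt , gt = N.inhabited (N.both (x≈y ε 0<ε) >ε) in ℚ.<-asym lt gt

#-sym : ∀ {x y} → x # y → y # x
#-sym {x} {y} (ε , 0<ε , >ε) = ε , 0<ε ,
  N.map (λ n → subst (ε ℚ.<_) (Rational.∣-∣-comm (seq x n) (seq y n))) >ε

private
  third : ℚ
  third = + 1 ℚ./ 3

  third-pos : ∀ {ε} → 0ℚ ℚ.< ε → 0ℚ ℚ.< ε ℚ.* third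
  third-pos 0<ε = Rational.*-pos 0<ε (ℚ.positive⁻¹ third)

  thirds : ∀ ε → ε ℚ.* third ℚ.+ (ε ℚ.* third ℚ.+ ε ℚ.* third) ≡ ε
  thirds ε = trans (cong (ε ℚ.* third ℚ.+_) (sym (ℚ.*-distribˡ-+ ε third third)))
    (trans (sym (ℚ.*-distribˡ-+ ε third (third ℚ.+ third))) (ℚ.*-identityʳ ε))

  separate : ∀ x ε → 0ℚ ℚ.< ε →
    (∃ λ δ → 0ℚ ℚ.< δ × Eventually λ n → δ ℚ.< ∣ seq x n ∣)
      ⊎ Eventually λ n → ∣ seq x n ∣ ℚ.< ε
  separate x ε 0<ε with cauchy x (ε ℚ.* third) (third-pos 0<ε)
  ... | N , osc with ∣ seq x N ∣ ℚ.<? ε ℚ.* third ℚ.+ ε ℚ.* third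
  ...   | yes lt = inj₂ (N , λ n N≤n → begin-strict
            ∣ seq x n ∣                              ≤⟨ Rational.∣p∣≤∣p-q∣+∣q∣ (seq x n) (seq x N) ⟩
            ∣ seq x n ℚ.- seq x N ∣ ℚ.+ ∣ seq x N ∣  <⟨ ℚ.+-mono-< (osc (n , N) (N≤n , ℕ.≤-refl)) lt ⟩
            δ ℚ.+ (δ ℚ.+ δ)                          ≡⟨ thirds ε ⟩
            ε                                        ∎)
    where open ℚ.≤-Reasoning
          δ = ε ℚ.* third
  ...   | no ≮ = inj₁ (δ , third-pos 0<ε , N , λ n N≤n → ℚ.≰⇒> λ ≤δ → ℚ.<-irrefl refl (begin-strict
            δ ℚ.+ δ                                  ≤⟨ ℚ.≮⇒≥ ≮ ⟩
            ∣ seq x N ∣                              ≤⟨ Rational.∣p∣≤∣p-q∣+∣q∣ (seq x N) (seq x n) ⟩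
            ∣ seq x N ℚ.- seq x n ∣ ℚ.+ ∣ seq x n ∣  <⟨ ℚ.+-mono-<-≤ (osc (N , n) (ℕ.≤-refl , N≤n)) ≤δ ⟩
            δ ℚ.+ δ                                  ∎))
    where open ℚ.≤-Reasoning
          δ = ε ℚ.* third

#-cotrans : Cotransitive _#_
#-cotrans {x} {y} (ε , 0<ε , >ε) z =
  compare (separate (x -ℝ z) η (Rational.half-pos 0<ε)) (separate (z -ℝ y) η (Rational.half-pos 0<ε))
  where
  open ℚ.≤-Reasoning
  η = ε ℚ.* ½

  impossible : ∀ p q r → ε ℚ.< ∣ p ℚ.- q ∣ × ∣ p ℚ.- r ∣ ℚ.< η × ∣ r ℚ.- q ∣ ℚ.< η → ⊥
  impossible p q r (lt , p-r< , r-q<) = ℚ.<-irrefl refl (begin-strict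
    ε                                  <⟨ lt ⟩
    ∣ p ℚ.- q ∣                        ≡⟨ cong ∣_∣ (Rational.telescope p r q) ⟨
    ∣ (p ℚ.- r) ℚ.+ (r ℚ.- q) ∣        ≤⟨ ℚ.∣p+q∣≤∣p∣+∣q∣ (p ℚ.- r) (r ℚ.- q) ⟩
    ∣ p ℚ.- r ∣ ℚ.+ ∣ r ℚ.- q ∣        <⟨ ℚ.+-mono-< p-r< r-q< ⟩
    η ℚ.+ η                            ≡⟨ Rational.half+half ε ⟩
    ε                                  ∎)

  compare : x # z ⊎ Eventually (λ n → ∣ seq x n ℚ.- seq z n ∣ ℚ.< η) →
            z # y ⊎ Eventually (λ n → ∣ seq z n ℚ.- seq y n ∣ ℚ.< η) →
            x # z ⊎ z # y
  compare (inj₁ x#z)  _           = inj₁ x#z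
  compare (inj₂ _)    (inj₁ z#y)  = inj₂ z#y
  compare (inj₂ x-z<) (inj₂ z-y<) =
    let n , both = N.inhabited (N.both >ε (N.both x-z< z-y<))
    in ⊥-elim (impossible (seq x n) (seq y n) (seq z n) both)

#-tight : Tight _≈ℝ_ _#_
#-tight x y = ¬#⇒≈ , #-irrefl {x} {y}
  where
  ¬#⇒≈ : ¬ x # y → x ≈ℝ y
  ¬#⇒≈ ¬x#y ε 0<ε = [ (λ x#y → ⊥-elim (¬x#y x#y)) , (λ x-y< → x-y<) ]′
    (separate (x -ℝ y) ε 0<ε)

#⇒invertible : ∀ {x y} → x # y → Invertible _≈ℝ_ 1ℝ _*ℝ_ (x -ℝ y)
#⇒invertible {x} {y} (ε , 0<ε , >ε) = r⁻¹ , left ,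
  ≈ℝ-trans {r *ℝ r⁻¹} {r⁻¹ *ℝ r} {1ℝ} (*ℝ-comm r r⁻¹) left
  where
  r r⁻¹ : ℝ
  r#0 : (x -ℝ y) # 0ℝ
  r   = x -ℝ y
  r#0 = ε , 0<ε , N.map (λ n → subst (λ p → ε ℚ.< ∣ p ∣) (sym (Rational.p-0≡p (seq r n)))) >ε
  r⁻¹ = recip r r#0
  left : r⁻¹ *ℝ r ≈ℝ 1ℝ
  left = recip-inverseˡ r r#0

invertible⇒# : ∀ {x y} → Invertible _≈ℝ_ 1ℝ _*ℝ_ (x -ℝ y) → x # y
invertible⇒# {x} {y} (z , zr≈1 , _) =
  let B , 0<B , z≤B = bounded z in
  conclude B 0<B z≤B
    (separate (x -ℝ y) (inv B ℚ.* ½) (Rational.*-pos (Rational.inv-pos 0<B) Rational.0<½))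
  where
  open ℚ.≤-Reasoning

  -- z (x - y) cannot be both below B · 1/(2B) = 1/2 and within 1/2 of 1.
  impossible : ∀ B p q → 0ℚ ℚ.< B →
    ∣ q ∣ ℚ.< inv B ℚ.* ½ × ∣ p ∣ ℚ.≤ B × ∣ p ℚ.* q ℚ.- 1ℚ ∣ ℚ.< ½ → ⊥
  impossible B p q 0<B (q< , p≤ , pq-1<) = ℚ.<-irrefl refl (begin-strict
    1ℚ                                      ≤⟨ Rational.∣p∣≤∣p-q∣+∣q∣ 1ℚ (p ℚ.* q) ⟩
    ∣ 1ℚ ℚ.- p ℚ.* q ∣ ℚ.+ ∣ p ℚ.* q ∣      ≡⟨ cong (ℚ._+ ∣ p ℚ.* q ∣) (Rational.∣-∣-comm 1ℚ (p ℚ.* q)) ⟩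
    ∣ p ℚ.* q ℚ.- 1ℚ ∣ ℚ.+ ∣ p ℚ.* q ∣      <⟨ ℚ.+-mono-<-≤ pq-1< pq≤½ ⟩
    1ℚ                                      ∎)
    where
    pq≤½ : ∣ p ℚ.* q ∣ ℚ.≤ ½
    pq≤½ = begin
      ∣ p ℚ.* q ∣            ≡⟨ ℚ.∣p*q∣≡∣p∣*∣q∣ p q ⟩
      ∣ p ∣ ℚ.* ∣ q ∣        ≤⟨ ℚ.*-monoʳ-≤-nonNeg ∣ q ∣ {{ℚ.∣-∣-nonNeg q}} p≤ ⟩
      B ℚ.* ∣ q ∣            ≤⟨ ℚ.*-monoˡ-≤-nonNeg B {{ℚ.pos⇒nonNeg B {{ℚ.positive 0<B}}}} (ℚ.<⇒≤ q<) ⟩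
      B ℚ.* (inv B ℚ.* ½)    ≡⟨ ℚ.*-assoc B (inv B) ½ ⟨
      (B ℚ.* inv B) ℚ.* ½    ≡⟨ cong (ℚ._* ½) (trans (ℚ.*-comm B (inv B)) (Rational.inv-inverse (Rational.>⇒≢ 0<B))) ⟩
      1ℚ ℚ.* ½               ≡⟨ ℚ.*-identityˡ ½ ⟩
      ½                      ∎

  conclude : ∀ B → 0ℚ ℚ.< B → Eventually (λ n → ∣ seq z n ∣ ℚ.≤ B) →
    x # y ⊎ Eventually (λ n → ∣ seq x n ℚ.- seq y n ∣ ℚ.< inv B ℚ.* ½) → x # y
  conclude B 0<B z≤B (inj₁ x#y)  = x#y
  conclude B 0<B z≤B (inj₂ x-y<) =
    let n , both = N.inhabited (N.both x-y< (N.both z≤B (zr≈1 ½ Rational.0<½)))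
    in ⊥-elim (impossible B (seq z n) (seq x n ℚ.- seq y n) 0<B both)

ℝ-heytingField : HeytingField 0ℓ 0ℓ 0ℓ
ℝ-heytingField = record
  { Carrier = ℝ
  ; _≈_ = _≈ℝ_
  ; _#_ = _#_
  ; _+_ = _+ℝ_
  ; _*_ = _*ℝ_
  ; -_ = -ℝ_
  ; 0#  = 0ℝ
  ; 1#  = 1ℝ
  ; isHeytingField = record
    { isHeytingCommutativeRing = record
      { isCommutativeRing   = ℝ-isCommutativeRing
      ; isApartnessRelation = record
        { irrefl  = λ {x} {y} → #-irrefl {x} {y}
        ; sym     = λ {x} {y} → #-sym {x} {y}
        ; cotrans = λ {x} {y} → #-cotrans {x} {y}
        }
      ; #⇒invertible = λ {x} {y} → #⇒invertible {x} {y}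
      ; invertible⇒# = λ {x} {y} → invertible⇒# {x} {y}
      }
    ; tight = #-tight
    }
  }

ℝ-commutativeRing : CommutativeRing 0ℓ 0ℓ
ℝ-commutativeRing =
  HeytingCommutativeRing.commutativeRing (HeytingField.heytingCommutativeRing ℝ-heytingField)

module MatrixAlgebra {c ℓ} (R : CommutativeRing c ℓ) where
  open CommutativeRing R using (Carrier; _≈_; _+_; _*_; 0#; 1#; +-commutativeMonoid)
  open CommutativeMonoidSum +-commutativeMonoid using (sum)

  infix  4 _≈ⱽ_ _≈ᴹ_ _∈Range_
  infixl 6 _+ᴹ_
  infixr 7 _•ⱽ_ _•ᴹ_ _*ⱽ_
  infixl 7 _*ᴹ_ _⊗_ _∙_
  infix  9 _ᵀ

  Vec : ℕ → Set c
  Vec n = Vector Carrier n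

  Matrix : ℕ → ℕ → Set c
  Matrix m n = Vector (Vec n) m

  _≈ⱽ_ : ∀ {n} → Vec n → Vec n → Set ℓ
  u ≈ⱽ v = ∀ i → u i ≈ v i

  _≈ᴹ_ : ∀ {m n} → Matrix m n → Matrix m n → Set ℓ
  A ≈ᴹ B = ∀ i j → A i j ≈ B i j

  𝐞 : ∀ {n} → Vec n
  𝐞 _ = 1#

  Oᴹ : ∀ {m n} → Matrix m n
  Oᴹ _ _ = 0#

  Iᴹ : ∀ {n} → Matrix n n
  Iᴹ i j = if ⌊ i ≟ᶠ j ⌋ then 1# else 0#

  _•ⱽ_ : ∀ {n} → Carrier → Vec n → Vec n
  (a •ⱽ v) i = a * v i

  _•ᴹ_ : ∀ {m n} → Carrier → Matrix m n → Matrix m n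
  (a •ᴹ A) i j = a * A i j

  _+ᴹ_ : ∀ {m n} → Matrix m n → Matrix m n → Matrix m n
  (A +ᴹ B) i j = A i j + B i j

  _ᵀ : ∀ {m n} → Matrix m n → Matrix n m
  (A ᵀ) i j = A j i

  -- u ∙ v is u′v and u ⊗ v is uv′, for column vectors u and v.
  _∙_ : ∀ {n} → Vec n → Vec n → Carrier
  u ∙ v = sum λ i → u i * v i

  _⊗_ : ∀ {m n} → Vec m → Vec n → Matrix m n
  (u ⊗ v) i j = u i * v j

  _*ⱽ_ : ∀ {m n} → Matrix m n → Vec n → Vec m
  (A *ⱽ v) i = sum λ k → A i k * v k

  _*ᴹ_ : ∀ {m n p} → Matrix m n → Matrix n p → Matrix m p
  (A *ᴹ B) i j = sum λ k → A i k * B k j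

  _∈Range_ : ∀ {m n} → Vec m → Matrix m n → Set (c Level.⊔ ℓ)
  v ∈Range A = ∃ λ u → A *ⱽ u ≈ⱽ v

  Symmetric : ∀ {n} → Matrix n n → Set ℓ
  Symmetric A = A ᵀ ≈ᴹ A

  record LaplacianLike {n} (L : Matrix n n) : Set ℓ where
    field
      symmetric    : Symmetric L
      zero-rowSums : ∀ i → sum (L i) ≈ 0#

  record Penrose {m n} (M : Matrix m n) (X : Matrix n m) : Set ℓ where
    field
      MXM≈M   : M *ᴹ X *ᴹ M ≈ᴹ M
      XMX≈X   : X *ᴹ M *ᴹ X ≈ᴹ X
      MX-symm : (M *ᴹ X) ᵀ ≈ᴹ M *ᴹ X
      XM-symm : (X *ᴹ M) ᵀ ≈ᴹ X *ᴹ M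

  infix 4 _†≈_

  -- M †≈ X reads M† = X: the definite description "the unique X
  -- satisfying the Penrose equations" is rendered as a relation.
  record _†≈_ {m n} (M : Matrix m n) (X : Matrix n m) : Set (c Level.⊔ ℓ) where
    field
      penrose : Penrose M X
      unique  : ∀ Y → Penrose M Y → Y ≈ᴹ X

open MatrixAlgebra ℝ-commutativeRing public

{-# OPTIONS --safe #-}

-- Write X = -½L + αww′ and P = XD.  If Dw = α⁻¹e, then P = -½LD + we′, so
-- LD + 2I = 2we′ + V says exactly V + 2P = 2I.  Hence V is symmetric iff P is,
-- DV = O iff DXD = D, and VX = O iff XDX = X.  As DX = P′, these are the
-- Penrose equations.  Conversely the Penrose equations give Dw = α⁻¹e: from
-- e = Du and Xe = αw one gets αDw = DXe = DXDu = Du = e.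
module Submission where

open import Algebra.Bundles using (CommutativeRing)
import Algebra.Properties.CommutativeSemigroup as CommutativeSemigroupProperties
import Algebra.Properties.Ring as RingProperties
import Algebra.Properties.Semiring.Sum as SemiringSum
open import Data.Bool.Base using (if_then_else_)
open import Data.Fin.Base using (Fin; zero; suc)
open import Data.Fin.Properties using (_≟_)
open import Data.Nat.Base using (ℕ)
open import Data.Product.Base using (∃; _×_; _,_)
open import Function.Bundles using (_⇔_; mk⇔)
open import Relation.Binary.Bundles using (Setoid)
open import Relation.Binary.PropositionalEquality using (_≡_; refl; cong)
open import Relation.Nullary.Decidable using (⌊⌋-map′)
import Data.Vec.Functional.Relation.Binary.Pointwise.Properties as Pointwise
import Relation.Binary.Reasoning.Setoid as SetoidReasoning

open import Defs using (module MatrixAlgebra)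

-- Matrix algebra over a commutative ring.

module MatrixProperties {c ℓ} (R : CommutativeRing c ℓ) where
  private module R = CommutativeRing R
  open R using (_≈_; _+_; _*_; 0#; 1#; setoid)
  open SemiringSum R.semiring
    using (sum; sum-cong-≋; sum-replicate-zero; ∑-distrib-+; ∑-comm; *-distribˡ-sum; *-distribʳ-sum)
  open CommutativeSemigroupProperties R.*-commutativeSemigroup using (x∙yz≈y∙xz)
  open MatrixAlgebra R

  matrixSetoid : ℕ → ℕ → Setoid c ℓ
  matrixSetoid m n = Pointwise.setoid (Pointwise.setoid setoid n) m

  ∙-congˡ : ∀ {n} (u : Vec n) {v v′ : Vec n} → v ≈ⱽ v′ → u ∙ v ≈ u ∙ v′
  ∙-congˡ u v≈v′ = sum-cong-≋ λ k → R.*-congˡ (v≈v′ k)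

  ∙-congʳ : ∀ {n} {u u′ : Vec n} (v : Vec n) → u ≈ⱽ u′ → u ∙ v ≈ u′ ∙ v
  ∙-congʳ v u≈u′ = sum-cong-≋ λ k → R.*-congʳ (u≈u′ k)

  ∙-comm : ∀ {n} (u v : Vec n) → u ∙ v ≈ v ∙ u
  ∙-comm u v = sum-cong-≋ λ k → R.*-comm (u k) (v k)

  *ᴹ-congˡ : ∀ {m n p} (A : Matrix m n) {B B′ : Matrix n p} →
    B ≈ᴹ B′ → A *ᴹ B ≈ᴹ A *ᴹ B′
  *ᴹ-congˡ A B≈B′ i j = ∙-congˡ (A i) λ k → B≈B′ k j

  *ᴹ-congʳ : ∀ {m n p} {A A′ : Matrix m n} (B : Matrix n p) →
    A ≈ᴹ A′ → A *ᴹ B ≈ᴹ A′ *ᴹ B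
  *ᴹ-congʳ B A≈A′ i j = ∙-congʳ (λ k → B k j) (A≈A′ i)

  -- Distributing both products gives a double sum over `k` and `l`, and `∑-comm` exchanges the two
  -- summations.
  *ⱽ-assoc : ∀ {m n p} (A : Matrix m n) (B : Matrix n p) (v : Vec p) →
    (A *ᴹ B) *ⱽ v ≈ⱽ A *ⱽ (B *ⱽ v)
  *ⱽ-assoc A B v i = begin
    sum (λ k → sum (λ l → A i l * B l k) * v k)    ≈⟨ sum-cong-≋ (λ k → *-distribʳ-sum (v k) λ l → A i l * B l k) ⟩
    sum (λ k → sum (λ l → A i l * B l k * v k))    ≈⟨ ∑-comm (λ k l → A i l * B l k * v k) ⟩
    sum (λ l → sum (λ k → A i l * B l k * v k))    ≈⟨ sum-cong-≋ (λ l → sum-cong-≋ λ k → R.*-assoc (A i l) (B l k) (v k)) ⟩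
    sum (λ l → sum (λ k → A i l * (B l k * v k)))  ≈⟨ sum-cong-≋ (λ l → *-distribˡ-sum (A i l) λ k → B l k * v k) ⟨
    sum (λ l → A i l * sum (λ k → B l k * v k))    ∎
    where open SetoidReasoning setoid

  -- Column `j` of a product is by definition the left factor applied to column `j` of the right
  -- factor, so the vector case suffices.
  *ᴹ-assoc : ∀ {m n p q} (A : Matrix m n) (B : Matrix n p) (C : Matrix p q) →
    A *ᴹ B *ᴹ C ≈ᴹ A *ᴹ (B *ᴹ C)
  *ᴹ-assoc A B C i j = *ⱽ-assoc A B (λ k → C k j) i

  ᵀ-*ᴹ : ∀ {m n p} (A : Matrix m n) (B : Matrix n p) → (A *ᴹ B) ᵀ ≈ᴹ B ᵀ *ᴹ A ᵀ
  ᵀ-*ᴹ A B i j = ∙-comm (A j) (λ k → B k i)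

  symmetric-*ᴹ : ∀ {n} {A B : Matrix n n} → Symmetric A → Symmetric B →
    (A *ᴹ B) ᵀ ≈ᴹ B *ᴹ A
  symmetric-*ᴹ {n} {A} {B} A-sym B-sym = begin
    (A *ᴹ B) ᵀ    ≈⟨ ᵀ-*ᴹ A B ⟩
    B ᵀ *ᴹ A ᵀ    ≈⟨ *ᴹ-congʳ (A ᵀ) B-sym ⟩
    B *ᴹ A ᵀ      ≈⟨ *ᴹ-congˡ B A-sym ⟩
    B *ᴹ A        ∎
    where open SetoidReasoning (matrixSetoid n n)

  ∙-distribˡ-+ : ∀ {n} (u v v′ : Vec n) → u ∙ (λ k → v k + v′ k) ≈ u ∙ v + u ∙ v′
  ∙-distribˡ-+ u v v′ = R.trans
    (sum-cong-≋ λ k → R.distribˡ (u k) (v k) (v′ k))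
    (∑-distrib-+ (λ k → u k * v k) (λ k → u k * v′ k))

  ∙-•ⱽ : ∀ {n} (u : Vec n) a (v : Vec n) → u ∙ (a •ⱽ v) ≈ a * (u ∙ v)
  ∙-•ⱽ u a v = R.trans
    (sum-cong-≋ λ k → x∙yz≈y∙xz (u k) a (v k))
    (R.sym (*-distribˡ-sum a λ k → u k * v k))

  ∙-distribʳ-+ : ∀ {n} (v u u′ : Vec n) → (λ k → u k + u′ k) ∙ v ≈ u ∙ v + u′ ∙ v
  ∙-distribʳ-+ v u u′ = R.trans
    (sum-cong-≋ λ k → R.distribʳ (v k) (u k) (u′ k))
    (∑-distrib-+ (λ k → u k * v k) (λ k → u′ k * v k))

  •ⱽ-∙ : ∀ {n} a (u v : Vec n) → (a •ⱽ u) ∙ v ≈ a * (u ∙ v)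
  •ⱽ-∙ a u v = R.trans
    (sum-cong-≋ λ k → R.*-assoc a (u k) (v k))
    (R.sym (*-distribˡ-sum a λ k → u k * v k))

  -- Equality of successors is decided by transporting the decision for the predecessors, which
  -- keeps the Boolean. This makes induction on the indices possible for `Iᴹ`.
  Iᴹ-suc : ∀ {n} (i j : Fin n) → Iᴹ (suc i) (suc j) ≡ Iᴹ i j
  Iᴹ-suc i j = cong (if_then 1# else 0#) (⌊⌋-map′ _ _ (i ≟ j))

  Iᴹ-symmetric : ∀ {n} → Symmetric (Iᴹ {n})
  Iᴹ-symmetric zero    zero    = R.refl
  Iᴹ-symmetric zero    (suc j) = R.refl
  Iᴹ-symmetric (suc i) zero    = R.refl
  Iᴹ-symmetric (suc i) (suc j) rewrite Iᴹ-suc i j | Iᴹ-suc j i = Iᴹ-symmetric i j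

  Iᴹ-*ⱽ : ∀ {n} (v : Vec n) → Iᴹ *ⱽ v ≈ⱽ v
  Iᴹ-*ⱽ {ℕ.suc n} v zero = begin
    1# * v zero + sum (λ k → 0# * v (suc k))
      ≈⟨ R.+-cong (R.*-identityˡ _) (sum-cong-≋ λ k → R.zeroˡ (v (suc k))) ⟩
    v zero + sum {n} (λ _ → 0#)    ≈⟨ R.+-congˡ (sum-replicate-zero n) ⟩
    v zero + 0#                    ≈⟨ R.+-identityʳ _ ⟩
    v zero                         ∎
    where open SetoidReasoning setoid
  Iᴹ-*ⱽ v (suc i) = begin
    0# * v zero + sum (λ k → Iᴹ (suc i) (suc k) * v (suc k))
      ≈⟨ R.+-cong (R.zeroˡ _) (sum-cong-≋ λ k → R.*-congʳ (R.reflexive (Iᴹ-suc i k))) ⟩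
    0# + (Iᴹ *ⱽ (λ k → v (suc k))) i    ≈⟨ R.+-identityˡ _ ⟩
    (Iᴹ *ⱽ (λ k → v (suc k))) i         ≈⟨ Iᴹ-*ⱽ (λ k → v (suc k)) i ⟩
    v (suc i)                           ∎
    where open SetoidReasoning setoid

  *ᴹ-identityˡ : ∀ {m n} (A : Matrix m n) → Iᴹ *ᴹ A ≈ᴹ A
  *ᴹ-identityˡ A i j = Iᴹ-*ⱽ (λ k → A k j) i

  *ᴹ-identityʳ : ∀ {m n} (A : Matrix m n) → A *ᴹ Iᴹ ≈ᴹ A
  *ᴹ-identityʳ {n = n} A i j = begin
    A i ∙ (λ k → Iᴹ k j)    ≈⟨ ∙-comm (A i) (λ k → Iᴹ k j) ⟩
    (λ k → Iᴹ k j) ∙ A i    ≈⟨ ∙-congʳ (A i) (Iᴹ-symmetric {n} j) ⟩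
    Iᴹ j ∙ A i              ≈⟨ Iᴹ-*ⱽ (A i) j ⟩
    A i j                   ∎
    where open SetoidReasoning setoid

  -- Uniqueness of the Moore-Penrose inverse.

  module _ {m n} {M : Matrix m n} {X Y : Matrix n m} (pX : Penrose M X) (pY : Penrose M Y) where
    private
      module X = Penrose pX
      module Y = Penrose pY

    -- Here MX = (MY)(MX), a product of two symmetric matrices, hence the transpose of (MX)(MY). By
    -- MXM = M the latter collapses to MY, which is symmetric.
    penrose-unique-MX : M *ᴹ X ≈ᴹ M *ᴹ Y
    penrose-unique-MX = begin
      M *ᴹ X                  ≈⟨ *ᴹ-congʳ X Y.MXM≈M ⟨
      M *ᴹ Y *ᴹ M *ᴹ X        ≈⟨ *ᴹ-assoc (M *ᴹ Y) M X ⟩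
      M *ᴹ Y *ᴹ (M *ᴹ X)      ≈⟨ symmetric-*ᴹ X.MX-symm Y.MX-symm ⟨
      -- Rewriting under a transpose means using the equation at swapped indices.
      (M *ᴹ X *ᴹ (M *ᴹ Y)) ᵀ  ≈⟨ (λ i j → *ᴹ-assoc (M *ᴹ X) M Y j i) ⟨
      (M *ᴹ X *ᴹ M *ᴹ Y) ᵀ    ≈⟨ (λ i j → *ᴹ-congʳ Y X.MXM≈M j i) ⟩
      (M *ᴹ Y) ᵀ              ≈⟨ Y.MX-symm ⟩
      M *ᴹ Y                  ∎
      where open SetoidReasoning (matrixSetoid m m)

    -- The mirror image: XM = (XM)(YM) is the transpose of (YM)(XM), which collapses to YM.
    penrose-unique-XM : X *ᴹ M ≈ᴹ Y *ᴹ M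
    penrose-unique-XM = begin
      X *ᴹ M                  ≈⟨ *ᴹ-congˡ X Y.MXM≈M ⟨
      X *ᴹ (M *ᴹ Y *ᴹ M)      ≈⟨ *ᴹ-congˡ X (*ᴹ-assoc M Y M) ⟩
      X *ᴹ (M *ᴹ (Y *ᴹ M))    ≈⟨ *ᴹ-assoc X M (Y *ᴹ M) ⟨
      X *ᴹ M *ᴹ (Y *ᴹ M)      ≈⟨ symmetric-*ᴹ Y.XM-symm X.XM-symm ⟨
      (Y *ᴹ M *ᴹ (X *ᴹ M)) ᵀ  ≈⟨ (λ i j → *ᴹ-assoc Y M (X *ᴹ M) j i) ⟩
      (Y *ᴹ (M *ᴹ (X *ᴹ M))) ᵀ  ≈⟨ (λ i j → *ᴹ-congˡ Y (*ᴹ-assoc M X M) j i) ⟨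
      (Y *ᴹ (M *ᴹ X *ᴹ M)) ᵀ  ≈⟨ (λ i j → *ᴹ-congˡ Y X.MXM≈M j i) ⟩
      (Y *ᴹ M) ᵀ              ≈⟨ Y.XM-symm ⟩
      Y *ᴹ M                  ∎
      where open SetoidReasoning (matrixSetoid n n)

    -- In X = XMX the factor XM may be replaced by YM, and then MX by MY.
    penrose-unique : X ≈ᴹ Y
    penrose-unique = begin
      X                ≈⟨ X.XMX≈X ⟨
      X *ᴹ M *ᴹ X      ≈⟨ *ᴹ-congʳ X penrose-unique-XM ⟩
      Y *ᴹ M *ᴹ X      ≈⟨ *ᴹ-assoc Y M X ⟩
      Y *ᴹ (M *ᴹ X)    ≈⟨ *ᴹ-congˡ Y penrose-unique-MX ⟩
      Y *ᴹ (M *ᴹ Y)    ≈⟨ *ᴹ-assoc Y M Y ⟨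
      Y *ᴹ M *ᴹ Y      ≈⟨ Y.XMX≈X ⟩
      Y                ∎
      where open SetoidReasoning (matrixSetoid n m)

-- The equivalence over a commutative ring.

module _ {c ℓ} (R : CommutativeRing c ℓ) where
  private module R = CommutativeRing R
  open R using (Carrier; _≈_; _+_; _*_; -_; 0#; 1#; setoid)
  open RingProperties R.ring
    using (//-rightDividesˡ; -‿distribˡ-*; +-cancelˡ; +-cancelʳ)
  open CommutativeSemigroupProperties R.*-commutativeSemigroup using (x∙yz≈y∙xz)
  open SemiringSum R.semiring using (sum-cong-≋)
  open MatrixAlgebra R
  open MatrixProperties R

  -- The scalars enter only through their equations: `two` and `half` are mutually inverse, and
  -- `α⁻¹` is an inverse of `α`. Over the reals they become 2, ½ and the reciprocal of α.
  module _
    (two half : Carrier) (half*two≈1 : half * two ≈ 1#)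
    {n} {D : Matrix n n} (D-sym : Symmetric D)
    {w : Vec n} (e∙w≈1 : 𝐞 ∙ w ≈ 1#)
    {L : Matrix n n} (L-lap : LaplacianLike L)
    (α α⁻¹ : Carrier) (α⁻¹*α≈1 : α⁻¹ * α ≈ 1#)
    where
    private
      module L = LaplacianLike L-lap

      X P : Matrix n n
      X = (- half) •ᴹ L +ᴹ α •ᴹ (w ⊗ w)
      P = X *ᴹ D

    two-cancel : ∀ {x y} → two * x ≈ two * y → x ≈ y
    two-cancel {x} {y} 2x≈2y = begin
      x                 ≈⟨ R.*-identityˡ x ⟨
      1# * x            ≈⟨ R.*-congʳ half*two≈1 ⟨
      half * two * x    ≈⟨ R.*-assoc half two x ⟩
      half * (two * x)  ≈⟨ R.*-congˡ 2x≈2y ⟩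
      half * (two * y)  ≈⟨ R.*-assoc half two y ⟨
      half * two * y    ≈⟨ R.*-congʳ half*two≈1 ⟩
      1# * y            ≈⟨ R.*-identityˡ y ⟩
      y                 ∎
      where open SetoidReasoning setoid

    -- The matrix `X` and its action on vectors.

    X-symmetric : Symmetric X
    X-symmetric i j = R.+-cong (R.*-congˡ (L.symmetric i j)) (R.*-congˡ (R.*-comm (w j) (w i)))

    -- The rank-one part sends v to a multiple of w, as ww′v = (w′v)w. This is applied to `𝐞` and to
    -- the columns of `D`.
    X-*ⱽ : ∀ v i → (X *ⱽ v) i ≈ - half * (L *ⱽ v) i + α * (w i * (w ∙ v))
    X-*ⱽ v i = begin
      (X *ⱽ v) i
        ≈⟨ ∙-distribʳ-+ v (- half •ⱽ L i) (α •ⱽ w i •ⱽ w) ⟩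
      (- half •ⱽ L i) ∙ v + (α •ⱽ w i •ⱽ w) ∙ v
        ≈⟨ R.+-cong (•ⱽ-∙ (- half) (L i) v)
                    (R.trans (•ⱽ-∙ α (w i •ⱽ w) v) (R.*-congˡ (•ⱽ-∙ (w i) w v))) ⟩
      - half * (L *ⱽ v) i + α * (w i * (w ∙ v)) ∎
      where open SetoidReasoning setoid

    -- Zero row sums give Le = 0, and e′w = 1 gives ww′e = w.
    X-*ⱽ-𝐞 : X *ⱽ 𝐞 ≈ⱽ α •ⱽ w
    X-*ⱽ-𝐞 i = begin
      (X *ⱽ 𝐞) i                                   ≈⟨ X-*ⱽ 𝐞 i ⟩
      - half * (L *ⱽ 𝐞) i + α * (w i * (w ∙ 𝐞))    ≈⟨ R.+-cong (R.*-congˡ Le≈0) (R.*-congˡ (R.*-congˡ w∙e≈1)) ⟩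
      - half * 0# + α * (w i * 1#)                 ≈⟨ R.+-cong (R.zeroʳ (- half)) (R.*-congˡ (R.*-identityʳ (w i))) ⟩
      0# + α * w i                                 ≈⟨ R.+-identityˡ _ ⟩
      α * w i                                      ∎
      where
      open SetoidReasoning setoid
      Le≈0 : (L *ⱽ 𝐞) i ≈ 0#
      Le≈0 = R.trans (sum-cong-≋ λ k → R.*-identityʳ (L i k)) (L.zero-rowSums i)
      w∙e≈1 : w ∙ 𝐞 ≈ 1#
      w∙e≈1 = R.trans (∙-comm w 𝐞) e∙w≈1

    penrose⇒Dw : 𝐞 ∈Range D → D *ᴹ X *ᴹ D ≈ᴹ D → D *ⱽ w ≈ⱽ α⁻¹ •ⱽ 𝐞
    penrose⇒Dw (u , Du≈e) DXD≈D i = begin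
      (D *ⱽ w) i                            ≈⟨ R.*-identityˡ _ ⟨
      1# * (D *ⱽ w) i                       ≈⟨ R.*-congʳ α⁻¹*α≈1 ⟨
      α⁻¹ * α * (D *ⱽ w) i                  ≈⟨ R.*-assoc α⁻¹ α _ ⟩
      α⁻¹ * (α * (D *ⱽ w) i)                ≈⟨ R.*-congˡ (∙-•ⱽ (D i) α w) ⟨
      α⁻¹ * (D *ⱽ (α •ⱽ w)) i               ≈⟨ R.*-congˡ (∙-congˡ (D i) X-*ⱽ-𝐞) ⟨
      α⁻¹ * (D *ⱽ (X *ⱽ 𝐞)) i               ≈⟨ R.*-congˡ (*ⱽ-assoc D X 𝐞 i) ⟨
      α⁻¹ * ((D *ᴹ X) *ⱽ 𝐞) i               ≈⟨ R.*-congˡ (∙-congˡ ((D *ᴹ X) i) Du≈e) ⟨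
      α⁻¹ * ((D *ᴹ X) *ⱽ (D *ⱽ u)) i        ≈⟨ R.*-congˡ (*ⱽ-assoc (D *ᴹ X) D u i) ⟨
      α⁻¹ * ((D *ᴹ X *ᴹ D) *ⱽ u) i          ≈⟨ R.*-congˡ (∙-congʳ u (DXD≈D i)) ⟩
      α⁻¹ * (D *ⱽ u) i                      ≈⟨ R.*-congˡ (Du≈e i) ⟩
      α⁻¹ * 1#                              ∎
      where open SetoidReasoning setoid

    -- From the Laplacian equation to V + 2P = 2I.

    -- As D is symmetric, w′D = (Dw)′ = α⁻¹e′, so αww′D = we′. Doubling turns -½LD into -LD, which
    -- the added LD cancels.
    two•P+LD : D *ⱽ w ≈ⱽ α⁻¹ •ⱽ 𝐞 → two •ᴹ P +ᴹ L *ᴹ D ≈ᴹ two •ᴹ (w ⊗ 𝐞)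
    two•P+LD Dw i j = begin
      two * P i j + LD                                        ≈⟨ R.+-congʳ (R.*-congˡ (X-*ⱽ (λ k → D k j) i)) ⟩
      two * (- half * LD + α * (w i * (w ∙ λ k → D k j))) + LD  ≈⟨ R.+-congʳ (R.*-congˡ (R.+-congˡ αww′D)) ⟩
      two * (- half * LD + w i * 1#) + LD                     ≈⟨ R.+-congʳ (R.distribˡ two _ _) ⟩
      two * (- half * LD) + two * (w i * 1#) + LD             ≈⟨ R.+-congʳ (R.+-congʳ two*-half) ⟩
      - LD + two * (w i * 1#) + LD                            ≈⟨ R.+-congʳ (R.+-comm _ _) ⟩
      two * (w i * 1#) + - LD + LD                            ≈⟨ //-rightDividesˡ LD _ ⟩
      two * (w i * 1#)                                        ∎
      where
      open SetoidReasoning setoid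
      LD = (L *ᴹ D) i j

      two*-half : two * (- half * LD) ≈ - LD
      two*-half = begin
        two * (- half * LD)    ≈⟨ x∙yz≈y∙xz two (- half) LD ⟩
        - half * (two * LD)    ≈⟨ R.*-assoc (- half) two LD ⟨
        - half * two * LD      ≈⟨ R.*-congʳ (-‿distribˡ-* half two) ⟨
        - (half * two) * LD    ≈⟨ R.*-congʳ (R.-‿cong half*two≈1) ⟩
        - 1# * LD              ≈⟨ -‿distribˡ-* 1# LD ⟨
        - (1# * LD)            ≈⟨ R.-‿cong (R.*-identityˡ LD) ⟩
        - LD                   ∎

      w∙Dʲ : w ∙ (λ k → D k j) ≈ α⁻¹
      w∙Dʲ = begin
        w ∙ (λ k → D k j)    ≈⟨ ∙-congˡ w (D-sym j) ⟩
        w ∙ D j              ≈⟨ ∙-comm w (D j) ⟩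
        (D *ⱽ w) j           ≈⟨ Dw j ⟩
        α⁻¹ * 1#             ≈⟨ R.*-identityʳ α⁻¹ ⟩
        α⁻¹                  ∎

      αww′D : α * (w i * (w ∙ λ k → D k j)) ≈ w i * 1#
      αww′D = begin
        α * (w i * (w ∙ λ k → D k j))    ≈⟨ R.*-congˡ (R.*-congˡ w∙Dʲ) ⟩
        α * (w i * α⁻¹)                  ≈⟨ x∙yz≈y∙xz α (w i) α⁻¹ ⟩
        w i * (α * α⁻¹)                  ≈⟨ R.*-congˡ (R.trans (R.*-comm α α⁻¹) α⁻¹*α≈1) ⟩
        w i * 1#                         ∎

    -- Putting LD in front allows it to be cancelled against the LD of LD + 2I, so the two forms of
    -- the equation on V translate into each other.
    two•we′+V : D *ⱽ w ≈ⱽ α⁻¹ •ⱽ 𝐞 → (V : Matrix n n) →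
      two •ᴹ (w ⊗ 𝐞) +ᴹ V ≈ᴹ L *ᴹ D +ᴹ (V +ᴹ two •ᴹ P)
    two•we′+V Dw V i j = begin
      two * (w i * 1#) + V i j               ≈⟨ R.+-congʳ (two•P+LD Dw i j) ⟨
      two * P i j + (L *ᴹ D) i j + V i j     ≈⟨ R.+-assoc _ _ _ ⟩
      two * P i j + ((L *ᴹ D) i j + V i j)   ≈⟨ R.+-comm _ _ ⟩
      (L *ᴹ D) i j + V i j + two * P i j     ≈⟨ R.+-assoc _ _ _ ⟩
      (L *ᴹ D) i j + (V i j + two * P i j)   ∎
      where open SetoidReasoning setoid

    -- Symmetry and Penrose equations read off from V + 2P = 2I.

    -- Multiplying V + 2P = 2I by D on the left links DV = O with DXD = D.
    D*V+two•DP : ∀ {V} → V +ᴹ two •ᴹ P ≈ᴹ two •ᴹ Iᴹ →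
      D *ᴹ V +ᴹ two •ᴹ (D *ᴹ X *ᴹ D) ≈ᴹ two •ᴹ D
    D*V+two•DP {V} V+2P≈2I i j = begin
      (D *ᴹ V) i j + two * (D *ᴹ X *ᴹ D) i j
        ≈⟨ R.+-congˡ (R.*-congˡ (*ᴹ-assoc D X D i j)) ⟩
      (D *ᴹ V) i j + two * (D *ᴹ P) i j
        ≈⟨ R.+-congˡ (∙-•ⱽ (D i) two (λ k → P k j)) ⟨
      (D *ᴹ V) i j + (D *ᴹ (two •ᴹ P)) i j
        ≈⟨ ∙-distribˡ-+ (D i) (λ k → V k j) (λ k → two * P k j) ⟨
      (D *ᴹ (V +ᴹ two •ᴹ P)) i j      ≈⟨ *ᴹ-congˡ D V+2P≈2I i j ⟩
      (D *ᴹ (two •ᴹ Iᴹ)) i j          ≈⟨ ∙-•ⱽ (D i) two (λ k → Iᴹ k j) ⟩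
      two * (D *ᴹ Iᴹ) i j             ≈⟨ R.*-congˡ (*ᴹ-identityʳ D i j) ⟩
      two * D i j                     ∎
      where open SetoidReasoning setoid

    -- Multiplying by X on the right links VX = O with XDX = X, since `P *ᴹ X` is XDX by definition.
    V*X+two•PX : ∀ {V} → V +ᴹ two •ᴹ P ≈ᴹ two •ᴹ Iᴹ →
      V *ᴹ X +ᴹ two •ᴹ (P *ᴹ X) ≈ᴹ two •ᴹ X
    V*X+two•PX {V} V+2P≈2I i j = begin
      (V *ᴹ X) i j + two * (P *ᴹ X) i j
        ≈⟨ R.+-congˡ (•ⱽ-∙ two (P i) (λ k → X k j)) ⟨
      (V *ᴹ X) i j + ((two •ᴹ P) *ᴹ X) i j
        ≈⟨ ∙-distribʳ-+ (λ k → X k j) (V i) (two •ⱽ P i) ⟨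
      ((V +ᴹ two •ᴹ P) *ᴹ X) i j      ≈⟨ *ᴹ-congʳ X V+2P≈2I i j ⟩
      ((two •ᴹ Iᴹ) *ᴹ X) i j          ≈⟨ •ⱽ-∙ two (Iᴹ i) (λ k → X k j) ⟩
      two * (Iᴹ *ᴹ X) i j             ≈⟨ R.*-congˡ (*ᴹ-identityˡ X i j) ⟩
      two * X i j                     ∎
      where open SetoidReasoning setoid

    -- Applied entrywise, with x from DV or VX and y from DXD or XDX. This direction divides by
    -- `two`, whereas its converse below only cancels a summand.
    x+two*y≈two*z⇒y≈z : ∀ {x y z} → x + two * y ≈ two * z → x ≈ 0# → y ≈ z
    x+two*y≈two*z⇒y≈z {x} {y} {z} x+2y≈2z x≈0 = two-cancel (begin
      two * y        ≈⟨ R.+-identityˡ _ ⟨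
      0# + two * y   ≈⟨ R.+-congʳ x≈0 ⟨
      x + two * y    ≈⟨ x+2y≈2z ⟩
      two * z        ∎)
      where open SetoidReasoning setoid

    x+two*y≈two*z⇒x≈0 : ∀ {x y z} → x + two * y ≈ two * z → y ≈ z → x ≈ 0#
    x+two*y≈two*z⇒x≈0 {x} {y} {z} x+2y≈2z y≈z = +-cancelʳ (two * y) x 0# (begin
      x + two * y    ≈⟨ x+2y≈2z ⟩
      two * z        ≈⟨ R.*-congˡ y≈z ⟨
      two * y        ≈⟨ R.+-identityˡ _ ⟨
      0# + two * y   ∎)
      where open SetoidReasoning setoid

    -- A multiple of the identity is symmetric. Once the sum is known to be symmetric, symmetry of
    -- either summand passes to the other.
    V+two•P-symmetric : ∀ {V} → V +ᴹ two •ᴹ P ≈ᴹ two •ᴹ Iᴹ → Symmetric (V +ᴹ two •ᴹ P)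
    V+two•P-symmetric V+2P≈2I i j = R.trans (V+2P≈2I j i)
      (R.trans (R.*-congˡ (Iᴹ-symmetric i j)) (R.sym (V+2P≈2I i j)))

    V-symmetric : ∀ {V} → V +ᴹ two •ᴹ P ≈ᴹ two •ᴹ Iᴹ → Symmetric P → Symmetric V
    V-symmetric {V} V+2P≈2I P-sym i j = +-cancelʳ (two * P i j) (V j i) (V i j)
      (R.trans (R.+-congˡ (R.*-congˡ (R.sym (P-sym i j)))) (V+two•P-symmetric V+2P≈2I i j))

    P-symmetric : ∀ {V} → V +ᴹ two •ᴹ P ≈ᴹ two •ᴹ Iᴹ → Symmetric V → Symmetric P
    P-symmetric {V} V+2P≈2I V-sym i j = two-cancel (+-cancelˡ (V i j) (two * P j i) (two * P i j)
      (R.trans (R.+-congʳ (R.sym (V-sym i j))) (V+two•P-symmetric V+2P≈2I i j)))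

    LD+two•I⇒V+two•P : ∀ {V} → D *ⱽ w ≈ⱽ α⁻¹ •ⱽ 𝐞 →
      L *ᴹ D +ᴹ two •ᴹ Iᴹ ≈ᴹ two •ᴹ (w ⊗ 𝐞) +ᴹ V → V +ᴹ two •ᴹ P ≈ᴹ two •ᴹ Iᴹ
    LD+two•I⇒V+two•P {V} Dw eq i j = R.sym (+-cancelˡ ((L *ᴹ D) i j) _ _
      (R.trans (eq i j) (two•we′+V Dw V i j)))

    V+two•P⇒LD+two•I : ∀ {V} → D *ⱽ w ≈ⱽ α⁻¹ •ⱽ 𝐞 →
      V +ᴹ two •ᴹ P ≈ᴹ two •ᴹ Iᴹ → L *ᴹ D +ᴹ two •ᴹ Iᴹ ≈ᴹ two •ᴹ (w ⊗ 𝐞) +ᴹ V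
    V+two•P⇒LD+two•I {V} Dw eq i j = R.trans
      (R.+-congˡ (R.sym (eq i j))) (R.sym (two•we′+V Dw V i j))

    -- The two implications.

    penrose⇒laplacianEquations :
      𝐞 ∈Range D → Penrose D X →
        (D *ⱽ w ≈ⱽ α⁻¹ •ⱽ 𝐞)
      × ∃ λ (V : Matrix n n) →
          Symmetric V
        × (L *ᴹ D +ᴹ two •ᴹ Iᴹ ≈ᴹ two •ᴹ (w ⊗ 𝐞) +ᴹ V)
        × (D *ᴹ V ≈ᴹ Oᴹ)
        × (V *ᴹ X ≈ᴹ Oᴹ)
    penrose⇒laplacianEquations e∈D pen =
      Dw , V , V-symmetric V+2P≈2I XM-symm , LD+2I≈2we′+V
         , (λ i j → x+two*y≈two*z⇒x≈0 (D*V+two•DP V+2P≈2I i j) (MXM≈M i j))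
         , (λ i j → x+two*y≈two*z⇒x≈0 (V*X+two•PX V+2P≈2I i j) (XMX≈X i j))
      where
      open Penrose pen
      V : Matrix n n
      -- The equation V + 2P = 2I leaves 2I - 2P as the only choice.
      V i j = two * Iᴹ i j + - (two * P i j)

      V+2P≈2I : V +ᴹ two •ᴹ P ≈ᴹ two •ᴹ Iᴹ
      V+2P≈2I i j = //-rightDividesˡ (two * P i j) (two * Iᴹ i j)

      Dw : D *ⱽ w ≈ⱽ α⁻¹ •ⱽ 𝐞
      Dw = penrose⇒Dw e∈D MXM≈M

      LD+2I≈2we′+V : L *ᴹ D +ᴹ two •ᴹ Iᴹ ≈ᴹ two •ᴹ (w ⊗ 𝐞) +ᴹ V
      LD+2I≈2we′+V = V+two•P⇒LD+two•I Dw V+2P≈2I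

    laplacianEquations⇒penrose : D *ⱽ w ≈ⱽ α⁻¹ •ⱽ 𝐞 →
      (V : Matrix n n) → Symmetric V →
      L *ᴹ D +ᴹ two •ᴹ Iᴹ ≈ᴹ two •ᴹ (w ⊗ 𝐞) +ᴹ V →
      D *ᴹ V ≈ᴹ Oᴹ → V *ᴹ X ≈ᴹ Oᴹ → Penrose D X
    laplacianEquations⇒penrose Dw V V-sym LD+2I≈2we′+V DV≈O VX≈O = record
      { MXM≈M   = λ i j → x+two*y≈two*z⇒y≈z (D*V+two•DP V+2P≈2I i j) (DV≈O i j)
      ; XMX≈X   = λ i j → x+two*y≈two*z⇒y≈z (V*X+two•PX V+2P≈2I i j) (VX≈O i j)
      ; MX-symm = λ i j → begin
          -- Both D and X are symmetric, so DX = P′ and its symmetry is that of P.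
          (D *ᴹ X) j i    ≈⟨ symmetric-*ᴹ D-sym X-symmetric i j ⟩
          P i j           ≈⟨ P-sym i j ⟨
          P j i           ≈⟨ symmetric-*ᴹ D-sym X-symmetric j i ⟨
          (D *ᴹ X) i j    ∎
      ; XM-symm = P-sym
      }
      where
      open SetoidReasoning setoid
      V+2P≈2I : V +ᴹ two •ᴹ P ≈ᴹ two •ᴹ Iᴹ
      V+2P≈2I = LD+two•I⇒V+two•P Dw LD+2I≈2we′+V

      P-sym : Symmetric P
      P-sym = P-symmetric V+2P≈2I V-sym

-- Specialisation to the real numbers.

open import Defs

theorem4p1 : (n : ℕ) (D : Matrix n n) → Symmetric D → 𝐞 ∈Range D →
    (w : Vec n) → 𝐞 ∙ w ≈ℝ 1ℝ →
    (L : Matrix n n) → LaplacianLike L →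
    (α : ℝ) (α#0 : α # 0ℝ) →
    (D †≈ (-ℝ ½ℝ) •ᴹ L +ᴹ α •ᴹ (w ⊗ w))
    ⇔
    ( (D *ⱽ w ≈ⱽ recip α α#0 •ⱽ 𝐞)
    × ∃ λ (V : Matrix n n) →
    Symmetric V
    × (L *ᴹ D +ᴹ 2ℝ •ᴹ Iᴹ ≈ᴹ 2ℝ •ᴹ (w ⊗ 𝐞) +ᴹ V)
    × (D *ᴹ V ≈ᴹ Oᴹ)
    × (V *ᴹ ((-ℝ ½ℝ) •ᴹ L +ᴹ α •ᴹ (w ⊗ w)) ≈ᴹ Oᴹ) )
theorem4p1 n D D-sym e∈D w e∙w≈1 L L-lap α α#0 = mk⇔
  (λ D†≈X → penrose⇒laplacianEquations ℝ-commutativeRing 2ℝ ½ℝ ½*2≈1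
    D-sym e∙w≈1 L-lap α (recip α α#0) (recip-inverseˡ α α#0) e∈D (_†≈_.penrose D†≈X))
  (λ { (Dw , V , V-sym , LD , DV , VX) →
    let pX = laplacianEquations⇒penrose ℝ-commutativeRing 2ℝ ½ℝ ½*2≈1
               D-sym e∙w≈1 L-lap α (recip α α#0) (recip-inverseˡ α α#0) Dw V V-sym LD DV VX
    in record { penrose = pX
              -- Any matrix satisfying the Penrose equations agrees with X by the general uniqueness
              -- result.
              ; unique  = λ Y pY → MatrixProperties.penrose-unique ℝ-commutativeRing pY pX } })
  where
  ½*2≈1 : ½ℝ *ℝ 2ℝ ≈ℝ 1ℝ
  -- Both sides are constant sequences, and the rational product evaluates to 1 at every index.
  ½*2≈1 = pointwise {½ℝ *ℝ 2ℝ} {1ℝ} λ _ → refl
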